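{- Asymmetric $R,\emptyset$-unification for one-sided distributivity is decidable: there is an algorithm that, given a finite set of asymmetric equations $\{s_1=^{\downarrow}t_1,\dots,s_n=^{\downarrow}t_n\}$ between terms built from $+$, $\times$ and variables, decides whether it has an asymmetric $R,\emptyset$-unifier.
   Context: Signature: binary symbols $+,\times$. $R=\{X\times(Y+Z)\to X\times Y+X\times Z\}$, $E=\emptyset$, and $\Delta$ is the equational theory generated by $X\times(Y+Z)=X\times Y+X\times Z$. $R$ is confluent and terminating; $t\downarrow$ denotes the $R$-normal form of $t$. A substitution $\delta$ is an asymmetric $R,\emptyset$-unifier of $\{s_1=^{\downarrow}t_1,\dots,s_n=^{\downarrow}t_n\}$ iff for each $i$, $\delta(s_i)=_\Delta\delta(t_i)$ and $(t_i\downarrow)\delta$ is in $R$-normal form. -}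

module Defs where

open import Data.Nat using (ℕ)
open import Data.Product using (Σ; _×_; _,_; ∃)
open import Data.List using (List)
open import Data.List.Relation.Unary.All using (All)
open import Relation.Nullary using (¬_)

infixl 6 _⊕_
infixl 7 _⊗_
data Term : Set where
  var : ℕ → Term
  _⊕_ : Term → Term → Term
  _⊗_ : Term → Term → Term

Subst : Set
Subst = ℕ → Term

_[_] : Term → Subst → Term
var x [ σ ] = σ x
(s ⊕ t) [ σ ] = (s [ σ ]) ⊕ (t [ σ ])
(s ⊗ t) [ σ ] = (s [ σ ]) ⊗ (t [ σ ])

data _≈Δ_ : Term → Term → Set where
  ax    : ∀ x y z → (x ⊗ (y ⊕ z)) ≈Δ ((x ⊗ y) ⊕ (x ⊗ z))
  refl  : ∀ {s} → s ≈Δ s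
  sym   : ∀ {s t} → s ≈Δ t → t ≈Δ s
  trans : ∀ {s t u} → s ≈Δ t → t ≈Δ u → s ≈Δ u
  cong⊕ : ∀ {s s' t t'} → s ≈Δ s' → t ≈Δ t' → (s ⊕ t) ≈Δ (s' ⊕ t')
  cong⊗ : ∀ {s s' t t'} → s ≈Δ s' → t ≈Δ t' → (s ⊗ t) ≈Δ (s' ⊗ t')

data _⟶_ : Term → Term → Set where
  root : ∀ x y z → (x ⊗ (y ⊕ z)) ⟶ ((x ⊗ y) ⊕ (x ⊗ z))
  ⊕ₗ   : ∀ {s s'} t → s ⟶ s' → (s ⊕ t) ⟶ (s' ⊕ t)
  ⊕ᵣ   : ∀ s {t t'} → t ⟶ t' → (s ⊕ t) ⟶ (s ⊕ t')
  ⊗ₗ   : ∀ {s s'} t → s ⟶ s' → (s ⊗ t) ⟶ (s' ⊗ t)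
  ⊗ᵣ   : ∀ s {t t'} → t ⟶ t' → (s ⊗ t) ⟶ (s ⊗ t')

data _⟶*_ : Term → Term → Set where
  done : ∀ {s} → s ⟶* s
  step : ∀ {s t u} → s ⟶ t → t ⟶* u → s ⟶* u

IsRNormal : Term → Set
IsRNormal u = ¬ (∃ λ v → u ⟶ v)

-- u is the R-normal form t↓ of t (unique since R is confluent and terminating)
IsNFof : Term → Term → Set
IsNFof t u = (t ⟶* u) × IsRNormal u

AsymEq : Set
AsymEq = Term × Term

AsymUnifiesEq : Subst → AsymEq → Set
AsymUnifiesEq δ (s , t) =
  ((s [ δ ]) ≈Δ (t [ δ ])) × (∀ u → IsNFof t u → IsRNormal (u [ δ ]))

IsAsymUnifier : Subst → List AsymEq → Set
IsAsymUnifier δ P = All (AsymUnifiesEq δ) P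

{-# OPTIONS --safe #-}
-- Modulo Δ, a term is a binary tree of ⊕'s whose leaves are products u₁ ⊗ (u₂ ⊗ … ⊗ x), and
-- multiplying by u on the left acts on each leaf without changing the shape of the tree.
-- Decidability follows from a small-model property.  Given a unifier δ, call a tree shape active
-- if it is the shape of some w[δ], w a subterm of the problem.  Pruning every sum of inactive
-- shape to its leftmost leaf commutes with the two operations wherever the problem applies them,
-- and leaves trees of bounded depth.  Then every product that is not a leaf of some pruned w[δ]
-- may be replaced by a variable.  Nested products that survive are distinct members of a set
-- of bounded size, so the resulting unifier has bounded height, and a finite search decides.
-- Neither step turns a non-sum into a sum, so the normal form constraints survive.
module Submission where

open import Defs
open import Data.Bool using (if_then_else_)
open import Data.Empty using (⊥-elim)
open import Data.List using (List; []; _∷_; _++_; map; concatMap; cartesianProductWith; length; upTo)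
open import Data.List.Properties using (length-++; length-map)
open import Data.List.Membership.Propositional using (_∈_; lose)
open import Data.List.Membership.Propositional.Properties
  using (∈-++⁺ˡ; ∈-++⁺ʳ; ∈-map⁺; ∈-concatMap⁺; ∈-cartesianProductWith⁺; ∈-upTo⁺)
import Data.List.Membership.DecPropositional as DecMembership
open import Data.List.Relation.Unary.All as All using (All; []; _∷_)
open import Data.List.Relation.Unary.All.Properties using (++⁻ˡ; ++⁻ʳ)
open import Data.List.Relation.Unary.Any as Any using (Any; here; there; any?)
open import Data.Nat using (ℕ; zero; suc; _+_; _*_; _^_; _∸_; _⊓_; _⊔_; _≤_; _<_; z≤n; s≤s)
import Data.Nat as ℕ
open import Data.Nat.Properties hiding (_≟_)
open import Data.Product using (∃; _×_; _,_; map₂)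
open import Function using (_∘_)
open import Relation.Binary.Definitions using (DecidableEquality)
open import Relation.Binary.PropositionalEquality as ≡ using (_≡_; cong; cong₂; subst)
open import Relation.Nullary using (Dec; yes; no; does; ¬_; contradiction)
open import Relation.Nullary.Decidable using (map′; _×-dec_)

_≟_ : DecidableEquality Term
var x   ≟ var y   = map′ (cong var) (λ { ≡.refl → ≡.refl }) (x ℕ.≟ y)
var _   ≟ (_ ⊕ _) = no λ ()
var _   ≟ (_ ⊗ _) = no λ ()
(_ ⊕ _) ≟ var _   = no λ ()
(s ⊕ t) ≟ (u ⊕ v) =
  map′ (λ { (≡.refl , ≡.refl) → ≡.refl }) (λ { ≡.refl → ≡.refl , ≡.refl }) ((s ≟ u) ×-dec (t ≟ v))
(_ ⊕ _) ≟ (_ ⊗ _) = no λ ()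
(_ ⊗ _) ≟ var _   = no λ ()
(_ ⊗ _) ≟ (_ ⊕ _) = no λ ()
(s ⊗ t) ≟ (u ⊗ v) =
  map′ (λ { (≡.refl , ≡.refl) → ≡.refl }) (λ { ≡.refl → ≡.refl , ≡.refl }) ((s ≟ u) ×-dec (t ≟ v))

open DecMembership _≟_ using (_∈?_)

-- Normal forms

infixl 6 _⊞_
infixr 7 _⊠_
-- The right factor of `_⊠_` is an `Atom`, never a sum, so no redex can be written: these are
-- exactly the R-normal terms.
mutual
  data NF : Set where
    at  : Atom → NF
    _⊞_ : NF → NF → NF

  data Atom : Set where
    v   : ℕ → Atom
    _⊠_ : NF → Atom → Atom

mutual
  ⌜_⌝ : NF → Term
  ⌜ at a ⌝  = ⌜ a ⌝ₐ
  ⌜ s ⊞ t ⌝ = ⌜ s ⌝ ⊕ ⌜ t ⌝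

  ⌜_⌝ₐ : Atom → Term
  ⌜ v x ⌝ₐ   = var x
  ⌜ u ⊠ a ⌝ₐ = ⌜ u ⌝ ⊗ ⌜ a ⌝ₐ

_▷_ : NF → NF → NF
u ▷ at a    = at (u ⊠ a)
u ▷ (s ⊞ t) = (u ▷ s) ⊞ (u ▷ t)

nf : Term → NF
nf (var x) = at (v x)
nf (s ⊕ t) = nf s ⊞ nf t
nf (s ⊗ t) = nf s ▷ nf t

mutual
  nf-⌜⌝ : ∀ n → nf ⌜ n ⌝ ≡ n
  nf-⌜⌝ (at a)  = nf-⌜⌝ₐ a
  nf-⌜⌝ (s ⊞ t) = cong₂ _⊞_ (nf-⌜⌝ s) (nf-⌜⌝ t)

  nf-⌜⌝ₐ : ∀ a → nf ⌜ a ⌝ₐ ≡ at a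
  nf-⌜⌝ₐ (v x)   = ≡.refl
  nf-⌜⌝ₐ (u ⊠ a) = cong₂ _▷_ (nf-⌜⌝ u) (nf-⌜⌝ₐ a)

⌜⌝-injective : ∀ {m n} → ⌜ m ⌝ ≡ ⌜ n ⌝ → m ≡ n
⌜⌝-injective {m} {n} eq = ≡.trans (≡.sym (nf-⌜⌝ m)) (≡.trans (cong nf eq) (nf-⌜⌝ n))

-- `nf` interprets terms in an algebra where the axiom holds by computation, as `▷` distributes over
-- `⊞`.
nf-cong : ∀ {s t} → s ≈Δ t → nf s ≡ nf t
nf-cong (ax x y z)  = ≡.refl
nf-cong refl        = ≡.refl
nf-cong (sym p)     = ≡.sym (nf-cong p)
nf-cong (trans p q) = ≡.trans (nf-cong p) (nf-cong q)
nf-cong (cong⊕ p q) = cong₂ _⊞_ (nf-cong p) (nf-cong q)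
nf-cong (cong⊗ p q) = cong₂ _▷_ (nf-cong p) (nf-cong q)

-- Rewriting

⟶⇒≈ : ∀ {s t} → s ⟶ t → s ≈Δ t
⟶⇒≈ (root x y z) = ax x y z
⟶⇒≈ (⊕ₗ t r)     = cong⊕ (⟶⇒≈ r) refl
⟶⇒≈ (⊕ᵣ s r)     = cong⊕ refl (⟶⇒≈ r)
⟶⇒≈ (⊗ₗ t r)     = cong⊗ (⟶⇒≈ r) refl
⟶⇒≈ (⊗ᵣ s r)     = cong⊗ refl (⟶⇒≈ r)

⟶*⇒≈ : ∀ {s t} → s ⟶* t → s ≈Δ t
⟶*⇒≈ done       = refl
⟶*⇒≈ (step r q) = trans (⟶⇒≈ r) (⟶*⇒≈ q)

⟶*-trans : ∀ {s t u} → s ⟶* t → t ⟶* u → s ⟶* u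
⟶*-trans done       q = q
⟶*-trans (step r p) q = step r (⟶*-trans p q)

⟶*-map : (f : Term → Term) → (∀ {s t} → s ⟶ t → f s ⟶ f t) → ∀ {s t} → s ⟶* t → f s ⟶* f t
⟶*-map f c done       = done
⟶*-map f c (step r p) = step (c r) (⟶*-map f c p)

⊕-⟶* : ∀ {s s′ t t′} → s ⟶* s′ → t ⟶* t′ → (s ⊕ t) ⟶* (s′ ⊕ t′)
⊕-⟶* {s′ = s′} {t} p q = ⟶*-trans (⟶*-map (_⊕ t) (⊕ₗ t) p) (⟶*-map (s′ ⊕_) (⊕ᵣ s′) q)

⊗-⟶* : ∀ {s s′ t t′} → s ⟶* s′ → t ⟶* t′ → (s ⊗ t) ⟶* (s′ ⊗ t′)
⊗-⟶* {s′ = s′} {t} p q = ⟶*-trans (⟶*-map (_⊗ t) (⊗ₗ t) p) (⟶*-map (s′ ⊗_) (⊗ᵣ s′) q)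

▷-⟶* : ∀ u t → (⌜ u ⌝ ⊗ ⌜ t ⌝) ⟶* ⌜ u ▷ t ⌝
▷-⟶* u (at a)  = done
▷-⟶* u (s ⊞ t) = step (root ⌜ u ⌝ ⌜ s ⌝ ⌜ t ⌝) (⊕-⟶* (▷-⟶* u s) (▷-⟶* u t))

nf-⟶* : ∀ t → t ⟶* ⌜ nf t ⌝
nf-⟶* (var x) = done
nf-⟶* (s ⊕ t) = ⊕-⟶* (nf-⟶* s) (nf-⟶* t)
nf-⟶* (s ⊗ t) = ⟶*-trans (⊗-⟶* (nf-⟶* s) (nf-⟶* t)) (▷-⟶* (nf s) (nf t))

nf-complete : ∀ {s t} → nf s ≡ nf t → s ≈Δ t
nf-complete {s} {t} eq =
  trans (⟶*⇒≈ (nf-⟶* s)) (subst (λ n → ⌜ n ⌝ ≈Δ t) (≡.sym eq) (sym (⟶*⇒≈ (nf-⟶* t))))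

IsSum : Term → Set
IsSum t = ∃ λ a → ∃ λ b → t ≡ a ⊕ b

⊕-normal : ∀ {s t} → IsRNormal s → IsRNormal t → IsRNormal (s ⊕ t)
⊕-normal p q (_ , ⊕ₗ _ r) = p (_ , r)
⊕-normal p q (_ , ⊕ᵣ _ r) = q (_ , r)

⊗-normal : ∀ {s t} → IsRNormal s → IsRNormal t → ¬ IsSum t → IsRNormal (s ⊗ t)
⊗-normal p q ns (_ , root _ _ _) = ns (_ , _ , ≡.refl)
⊗-normal p q ns (_ , ⊗ₗ _ r)     = p (_ , r)
⊗-normal p q ns (_ , ⊗ᵣ _ r)     = q (_ , r)

⊗-normal⁻ : ∀ {s t} → IsRNormal (s ⊗ t) → ¬ IsSum t
⊗-normal⁻ p (_ , _ , ≡.refl) = p (_ , root _ _ _)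

⌜⌝ₐ-nonSum : ∀ a → ¬ IsSum ⌜ a ⌝ₐ
⌜⌝ₐ-nonSum (v _)   (_ , _ , ())
⌜⌝ₐ-nonSum (_ ⊠ _) (_ , _ , ())

mutual
  ⌜⌝-normal : ∀ n → IsRNormal ⌜ n ⌝
  ⌜⌝-normal (at a)  = ⌜⌝ₐ-normal a
  ⌜⌝-normal (s ⊞ t) = ⊕-normal (⌜⌝-normal s) (⌜⌝-normal t)

  ⌜⌝ₐ-normal : ∀ a → IsRNormal ⌜ a ⌝ₐ
  ⌜⌝ₐ-normal (v _)   (_ , ())
  ⌜⌝ₐ-normal (u ⊠ a) = ⊗-normal (⌜⌝-normal u) (⌜⌝ₐ-normal a) (⌜⌝ₐ-nonSum a)

normal⇒≡nf : ∀ {t} → IsRNormal t → t ≡ ⌜ nf t ⌝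
normal⇒≡nf {t} p = stuck (nf-⟶* t)
  where
  stuck : ∀ {u} → t ⟶* u → t ≡ u
  stuck done       = ≡.refl
  stuck (step r _) = ⊥-elim (p (_ , r))

normal? : ∀ t → Dec (IsRNormal t)
normal? t = map′ (λ eq → subst IsRNormal (≡.sym eq) (⌜⌝-normal (nf t))) normal⇒≡nf (t ≟ ⌜ nf t ⌝)

nf-isNF : ∀ t → IsNFof t ⌜ nf t ⌝
nf-isNF t = nf-⟶* t , ⌜⌝-normal (nf t)

-- Rewriting preserves Δ-equality, hence `nf`, and normal terms are fixed by `nf`; this stands in
-- for confluence.
nf-unique : ∀ {t u} → IsNFof t u → u ≡ ⌜ nf t ⌝
nf-unique (r , p) = ≡.trans (normal⇒≡nf p) (cong ⌜_⌝ (≡.sym (nf-cong (⟶*⇒≈ r))))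

-- Unification in terms of computed normal forms

UnifiesNF : Subst → AsymEq → Set
UnifiesNF δ (s , t) = nf (s [ δ ]) ≡ nf (t [ δ ]) × IsRNormal (⌜ nf t ⌝ [ δ ])

unifies⇒ : ∀ {δ} e → AsymUnifiesEq δ e → UnifiesNF δ e
unifies⇒ (s , t) (p , q) = nf-cong p , q _ (nf-isNF t)

unifies⇐ : ∀ {δ} e → UnifiesNF δ e → AsymUnifiesEq δ e
unifies⇐ {δ} (s , t) (p , q) =
  nf-complete p , λ u isnf → subst (λ w → IsRNormal (w [ δ ])) (≡.sym (nf-unique isnf)) q

unifiesNF? : ∀ δ e → Dec (UnifiesNF δ e)
unifiesNF? δ (s , t) =
  map′ ⌜⌝-injective (cong ⌜_⌝) (⌜ nf (s [ δ ]) ⌝ ≟ ⌜ nf (t [ δ ]) ⌝) ×-dec normal? (⌜ nf t ⌝ [ δ ])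

-- Ranks in a finite set of sizes

size : Term → ℕ
size (var _) = 0
size (s ⊕ t) = suc (size s + size t)
size (s ⊗ t) = suc (size s + size t)

-- Each summand is 1 if size t ≤ n and 0 otherwise, because of truncated subtraction.
rank : List Term → ℕ → ℕ
rank []      n = 0
rank (t ∷ L) n = (suc n ∸ size t) ⊓ 1 + rank L n

rank≤length : ∀ L n → rank L n ≤ length L
rank≤length []      n = z≤n
rank≤length (t ∷ L) n = +-mono-≤ (m⊓n≤n (suc n ∸ size t) 1) (rank≤length L n)

rank-mono : ∀ L {m n} → m ≤ n → rank L m ≤ rank L n
rank-mono []      m≤n = z≤n
rank-mono (t ∷ L) m≤n =
  +-mono-≤ (⊓-monoˡ-≤ 1 (∸-monoˡ-≤ (size t) (s≤s m≤n))) (rank-mono L m≤n)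

-- The entry `t` counts at `size t` but not at `m`. So a strictly nested chain of members of `L` has
-- length at most `length L`, which drives every bound below.
rank-strict : ∀ L {m t} → m < size t → t ∈ L → rank L m < rank L (size t)
rank-strict (t ∷ L) m<t (here ≡.refl)
  rewrite m≤n⇒m∸n≡0 m<t | m+n∸n≡m 1 (size t) = s≤s (rank-mono L (<⇒≤ m<t))
rank-strict (u ∷ L) m<t (there i) =
  +-mono-≤-< (⊓-monoˡ-≤ 1 (∸-monoˡ-≤ (size u) (s≤s (<⇒≤ m<t)))) (rank-strict L m<t i)

-- Collapsing normal forms

-- Shapes are encoded as terms with a single variable and no ⊗.
shape : NF → Term
shape (at _)  = var 0
shape (s ⊞ t) = shape s ⊕ shape t

shape-▷ : ∀ u t → shape (u ▷ t) ≡ shape t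
shape-▷ u (at _)  = ≡.refl
shape-▷ u (s ⊞ t) = cong₂ _⊕_ (shape-▷ u s) (shape-▷ u t)

leftmost : NF → Atom
leftmost (at a)  = a
leftmost (s ⊞ _) = leftmost s

leftmost-▷ : ∀ u t → leftmost (u ▷ t) ≡ u ⊠ leftmost t
leftmost-▷ u (at _)  = ≡.refl
leftmost-▷ u (s ⊞ _) = leftmost-▷ u s

-- Surviving leaves are kept as the original atoms; the branching has to match that of `collapse`.
prunedLeaves : List Term → NF → List Atom
prunedLeaves S (at a)  = a ∷ []
prunedLeaves S (s ⊞ t) =
  if does (shape (s ⊞ t) ∈? S) then prunedLeaves S s ++ prunedLeaves S t else leftmost s ∷ []

rank-⊕ : ∀ S {s t} → (s ⊕ t) ∈ S →
         suc (rank S (size s) ⊔ rank S (size t)) ≤ rank S (size (s ⊕ t))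
rank-⊕ S {s} {t} i = ⊔-lub (rank-strict S (s≤s (m≤m+n _ _)) i) (rank-strict S (s≤s (m≤n+m _ (size s))) i)

-- Every unpruned `⊞` has an active shape and costs a unit of rank by `rank-⊕`; a binary tree of
-- depth d has at most 2^d leaves.
length-prunedLeaves : ∀ S n → length (prunedLeaves S n) ≤ 2 ^ rank S (size (shape n))
length-prunedLeaves S (at a)  = m^n>0 2 (rank S 0)
length-prunedLeaves S (s ⊞ t) with shape (s ⊞ t) ∈? S
... | no _  = m^n>0 2 (rank S (size (shape (s ⊞ t))))
... | yes i = begin
  length (prunedLeaves S s ++ prunedLeaves S t)
    ≡⟨ length-++ (prunedLeaves S s) ⟩
  length (prunedLeaves S s) + length (prunedLeaves S t)
    ≤⟨ +-mono-≤ (≤-trans (length-prunedLeaves S s) (^-monoʳ-≤ 2 (m≤m⊔n r₁ r₂)))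
                (≤-trans (length-prunedLeaves S t) (^-monoʳ-≤ 2 (m≤n⊔m r₁ r₂))) ⟩
  2 ^ (r₁ ⊔ r₂) + 2 ^ (r₁ ⊔ r₂)
    ≡⟨ cong (2 ^ (r₁ ⊔ r₂) +_) (+-identityʳ _) ⟨
  2 ^ suc (r₁ ⊔ r₂)
    ≤⟨ ^-monoʳ-≤ 2 (rank-⊕ S i) ⟩
  2 ^ rank S (size (shape (s ⊞ t))) ∎
  where
  open ≤-Reasoning
  r₁ = rank S (size (shape s))
  r₂ = rank S (size (shape t))

-- A variable counts with its index, so that only finitely many terms have a given height.
height : Term → ℕ
height (var x) = x
height (s ⊕ t) = suc (height s ⊔ height t)
height (s ⊗ t) = suc (height s ⊔ height t)

-- `S` lists the active shapes and `A` the products to keep. Pruning and replacement by a variable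
-- happen in one recursion.
module Collapse (S A : List Term) where

  mutual
    collapse : NF → NF
    collapse (at a)  = at (collapseₐ a)
    collapse (s ⊞ t) =
      if does (shape (s ⊞ t) ∈? S) then collapse s ⊞ collapse t else at (collapseLeft s)

    -- A recursion of its own keeps the definition structural, as `leftmost s` is not syntactically
    -- a part of `s`.
    collapseLeft : NF → Atom
    collapseLeft (at a)  = collapseₐ a
    collapseLeft (s ⊞ _) = collapseLeft s

    collapseₐ : Atom → Atom
    -- All variables are merged into the default `v 0`, since `height` counts indices.
    collapseₐ (v _)   = v 0
    collapseₐ (u ⊠ a) = if does (⌜ u ⊠ a ⌝ₐ ∈? A) then collapse u ⊠ collapseₐ a else v 0

  collapse-⊞ : ∀ s t → shape (s ⊞ t) ∈ S → collapse (s ⊞ t) ≡ collapse s ⊞ collapse t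
  collapse-⊞ s t i with shape (s ⊞ t) ∈? S
  ... | yes _ = ≡.refl
  ... | no ¬i = contradiction i ¬i

  collapseₐ-⊠ : ∀ u a → ⌜ u ⊠ a ⌝ₐ ∈ A → collapseₐ (u ⊠ a) ≡ collapse u ⊠ collapseₐ a
  collapseₐ-⊠ u a i with ⌜ u ⊠ a ⌝ₐ ∈? A
  ... | yes _ = ≡.refl
  ... | no ¬i = contradiction i ¬i

  collapseLeft-leftmost : ∀ n → collapseLeft n ≡ collapseₐ (leftmost n)
  collapseLeft-leftmost (at _)  = ≡.refl
  collapseLeft-leftmost (s ⊞ _) = collapseLeft-leftmost s

  -- Corresponding nodes of `u ▷ n` and `n` have equal shapes and are pruned alike; the hypothesis
  -- keeps each surviving product `u ⊠ a`.
  collapse-▷ : ∀ u n → All (λ a → ⌜ a ⌝ₐ ∈ A) (prunedLeaves S (u ▷ n)) →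
               collapse (u ▷ n) ≡ collapse u ▷ collapse n
  collapse-▷ u (at a)  (i ∷ _) = cong at (collapseₐ-⊠ u a i)
  collapse-▷ u (s ⊞ t) is rewrite shape-▷ u s | shape-▷ u t with shape (s ⊞ t) ∈? S
  ... | yes _ = cong₂ _⊞_ (collapse-▷ u s (++⁻ˡ (prunedLeaves S (u ▷ s)) is))
                          (collapse-▷ u t (++⁻ʳ (prunedLeaves S (u ▷ s)) is))
  -- In a pruned sum only the leftmost leaf survives, and taking it commutes with `u ▷_`.
  collapse-▷ u (s ⊞ t) (i ∷ _) | no _ = cong at (begin
    collapseLeft (u ▷ s)               ≡⟨ collapseLeft-leftmost (u ▷ s) ⟩
    collapseₐ (leftmost (u ▷ s))       ≡⟨ cong collapseₐ (leftmost-▷ u s) ⟩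
    collapseₐ (u ⊠ leftmost s)         ≡⟨ collapseₐ-⊠ u _ (subst (λ a → ⌜ a ⌝ₐ ∈ A) (leftmost-▷ u s) i) ⟩
    collapse u ⊠ collapseₐ (leftmost s) ≡⟨ cong (collapse u ⊠_) (collapseLeft-leftmost s) ⟨
    collapse u ⊠ collapseLeft s        ∎)
    where open ≡.≡-Reasoning

  private
    k = length S

    -- One unit of rank in `A` pays for `suc k` levels: a `⊗` and up to `k` nested `⊕` in its left
    -- factor.
    bound : ℕ → ℕ
    bound n = rank A n * suc k

    bound-mono : ∀ {m n} → m ≤ n → bound m ≤ bound n
    bound-mono m≤n = *-monoˡ-≤ (suc k) (rank-mono A m≤n)

  mutual
    -- The first summand pays for the products, the second for the active sums above them.
    height-collapse : ∀ n → height ⌜ collapse n ⌝ ≤ bound (size ⌜ n ⌝) + rank S (size (shape n))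
    height-collapse (at a)  = ≤-trans (height-collapseₐ a) (m≤m+n _ _)
    height-collapse (s ⊞ t) with shape (s ⊞ t) ∈? S
    ... | no _  = begin
      height ⌜ collapseLeft s ⌝ₐ ≤⟨ height-collapseLeft s ⟩
      bound (size ⌜ s ⌝)         ≤⟨ bound-mono s≤ ⟩
      bound (size ⌜ s ⊞ t ⌝)     ≤⟨ m≤m+n _ _ ⟩
      bound (size ⌜ s ⊞ t ⌝) + rank S (size (shape (s ⊞ t))) ∎
      where
      open ≤-Reasoning
      s≤ : size ⌜ s ⌝ ≤ size ⌜ s ⊞ t ⌝
      s≤ = m≤n⇒m≤1+n (m≤m+n _ _)
    ... | yes i = begin
      suc (height ⌜ collapse s ⌝ ⊔ height ⌜ collapse t ⌝)
        ≤⟨ s≤s (⊔-mono-≤ (height-collapse s) (height-collapse t)) ⟩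
      suc ((bound (size ⌜ s ⌝) + r₁) ⊔ (bound (size ⌜ t ⌝) + r₂))
        ≤⟨ s≤s (⊔-lub (+-mono-≤ (bound-mono (m≤n⇒m≤1+n (m≤m+n _ _))) (m≤m⊔n r₁ r₂))
                      (+-mono-≤ (bound-mono (m≤n⇒m≤1+n (m≤n+m _ (size ⌜ s ⌝)))) (m≤n⊔m r₁ r₂))) ⟩
      suc (bound (size ⌜ s ⊞ t ⌝) + (r₁ ⊔ r₂))
        ≡⟨ +-suc _ _ ⟨
      bound (size ⌜ s ⊞ t ⌝) + suc (r₁ ⊔ r₂)
        ≤⟨ +-monoʳ-≤ (bound (size ⌜ s ⊞ t ⌝)) (rank-⊕ S i) ⟩
      bound (size ⌜ s ⊞ t ⌝) + rank S (size (shape (s ⊞ t))) ∎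
      where
      open ≤-Reasoning
      r₁ = rank S (size (shape s))
      r₂ = rank S (size (shape t))

    height-collapseLeft : ∀ n → height ⌜ collapseLeft n ⌝ₐ ≤ bound (size ⌜ n ⌝)
    height-collapseLeft (at a)  = height-collapseₐ a
    height-collapseLeft (s ⊞ t) =
      ≤-trans (height-collapseLeft s) (bound-mono (m≤n⇒m≤1+n (m≤m+n _ _)))

    height-collapseₐ : ∀ a → height ⌜ collapseₐ a ⌝ₐ ≤ bound (size ⌜ a ⌝ₐ)
    height-collapseₐ (v _)   = z≤n
    height-collapseₐ (u ⊠ a) with ⌜ u ⊠ a ⌝ₐ ∈? A
    ... | no _  = z≤n
    ... | yes i = begin
      suc (height ⌜ collapse u ⌝ ⊔ height ⌜ collapseₐ a ⌝ₐ)
        ≤⟨ s≤s (⊔-lub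
             (≤-trans (height-collapse u)
               (+-mono-≤ (*-monoˡ-≤ (suc k) (m≤m⊔n r₁ r₂)) (rank≤length S _)))
             (≤-trans (height-collapseₐ a)
               (≤-trans (*-monoˡ-≤ (suc k) (m≤n⊔m r₁ r₂)) (m≤m+n _ k)))) ⟩
      suc ((r₁ ⊔ r₂) * suc k + k)
        ≡⟨ cong suc (+-comm _ k) ⟩
      -- The kept product is in `A` and larger than both factors, so its rank exceeds theirs.
      suc (r₁ ⊔ r₂) * suc k
        ≤⟨ *-monoˡ-≤ (suc k) (⊔-lub (rank-strict A (s≤s (m≤m+n _ _)) i)
                                    (rank-strict A (s≤s (m≤n+m _ (size ⌜ u ⌝))) i)) ⟩
      bound (size ⌜ u ⊠ a ⌝ₐ) ∎
      where
      open ≤-Reasoning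
      r₁ = rank A (size ⌜ u ⌝)
      r₂ = rank A (size ⌜ a ⌝ₐ)

-- The small-model property

subterms : Term → List Term
subterms (var x) = var x ∷ []
subterms (s ⊕ t) = (s ⊕ t) ∷ subterms s ++ subterms t
subterms (s ⊗ t) = (s ⊗ t) ∷ subterms s ++ subterms t

sides : List AsymEq → List Term
sides = concatMap λ (s , t) → s ∷ t ∷ []

complexity : List AsymEq → ℕ
complexity P = length (concatMap subterms (sides P))

-- For `k` parts there are at most `k` active shapes and `2 ^ k` surviving leaves per part, hence
-- `k * 2 ^ k` kept products.
heightBound : ℕ → ℕ
heightBound k = (k * 2 ^ k) * suc k + k

length-concatMap≤ : ∀ {X Y : Set} (f : X → List Y) {b} → (∀ x → length (f x) ≤ b) →
                    ∀ xs → length (concatMap f xs) ≤ length xs * b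
length-concatMap≤ f f≤ []       = z≤n
length-concatMap≤ f f≤ (x ∷ xs) =
  ≤-trans (≤-reflexive (length-++ (f x))) (+-mono-≤ (f≤ x) (length-concatMap≤ f f≤ xs))

module SmallModel (P : List AsymEq) (δ : Subst) where

  value : Term → NF
  value w = nf (w [ δ ])

  parts : List Term
  parts = concatMap subterms (sides P)

  S : List Term
  S = map (shape ∘ value) parts

  leavesOf : Term → List Term
  leavesOf w = map ⌜_⌝ₐ (prunedLeaves S (value w))

  A : List Term
  A = concatMap leavesOf parts

  open Collapse S A

  δ′ : Subst
  δ′ x = ⌜ collapse (nf (δ x)) ⌝

  length-S : length S ≡ complexity P
  length-S = length-map (shape ∘ value) parts

  length-A : length A ≤ complexity P * 2 ^ complexity P
  length-A = length-concatMap≤ leavesOf leaves≤ parts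
    where
    open ≤-Reasoning
    leaves≤ : ∀ w → length (leavesOf w) ≤ 2 ^ complexity P
    leaves≤ w = begin
      length (leavesOf w)                 ≡⟨ length-map ⌜_⌝ₐ (prunedLeaves S (value w)) ⟩
      length (prunedLeaves S (value w))   ≤⟨ length-prunedLeaves S (value w) ⟩
      2 ^ rank S (size (shape (value w))) ≤⟨ ^-monoʳ-≤ 2 (rank≤length S _) ⟩
      2 ^ length S                        ≡⟨ cong (2 ^_) length-S ⟩
      2 ^ complexity P                    ∎

  height-δ′ : ∀ x → height (δ′ x) ≤ heightBound (complexity P)
  height-δ′ x = begin
    height (δ′ x)
      ≤⟨ height-collapse (nf (δ x)) ⟩
    rank A (size ⌜ nf (δ x) ⌝) * suc (length S) + rank S (size (shape (nf (δ x))))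
      ≤⟨ +-mono-≤ (*-monoˡ-≤ (suc (length S)) (≤-trans (rank≤length A _) length-A)) (rank≤length S _) ⟩
    complexity P * 2 ^ complexity P * suc (length S) + length S
      ≡⟨ cong (λ k → complexity P * 2 ^ complexity P * suc k + k) length-S ⟩
    heightBound (complexity P) ∎
    where open ≤-Reasoning

  -- `S` and `A` are chosen for this: the value of each part has an active shape, so `collapse`
  -- commutes with `⊞` there, and its surviving leaves are in `A`, so it commutes with `▷`.
  value-δ′ : ∀ w → All (_∈ parts) (subterms w) → nf (w [ δ′ ]) ≡ collapse (value w)
  value-δ′ (var x) _        = nf-⌜⌝ _
  value-δ′ (s ⊕ t) (i ∷ is) = ≡.trans
    (cong₂ _⊞_ (value-δ′ s (++⁻ˡ (subterms s) is)) (value-δ′ t (++⁻ʳ (subterms s) is)))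
    (≡.sym (collapse-⊞ (value s) (value t) (∈-map⁺ (shape ∘ value) i)))
  value-δ′ (s ⊗ t) (i ∷ is) = ≡.trans
    (cong₂ _▷_ (value-δ′ s (++⁻ˡ (subterms s) is)) (value-δ′ t (++⁻ʳ (subterms s) is)))
    (≡.sym (collapse-▷ (value s) (value t)
      (All.tabulate λ j → ∈-concatMap⁺ leavesOf (lose i (∈-map⁺ ⌜_⌝ₐ j)))))

  -- A normal `δ x` that is no sum has an atom as its normal form, and `collapse` sends atoms to
  -- atoms.
  nonSum-δ′ : ∀ x → IsRNormal (δ x) → ¬ IsSum (δ x) → ¬ IsSum (δ′ x)
  nonSum-δ′ x p ns with nf (δ x) | normal⇒≡nf p
  ... | at a  | _  = ⌜⌝ₐ-nonSum (collapseₐ a)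
  ... | s ⊞ t | eq = contradiction (_ , _ , eq) ns

  mutual
    -- The values of `δ′` are normal, so a redex could only come from a variable in right-factor
    -- position receiving a sum; `nonSum-δ′` excludes this.
    normal-δ′ : ∀ n → IsRNormal (⌜ n ⌝ [ δ ]) → IsRNormal (⌜ n ⌝ [ δ′ ])
    normal-δ′ (at a)  p = normal-δ′ₐ a p
    normal-δ′ (s ⊞ t) p = ⊕-normal (normal-δ′ s λ (_ , r) → p (_ , ⊕ₗ _ r))
                                   (normal-δ′ t λ (_ , r) → p (_ , ⊕ᵣ _ r))

    normal-δ′ₐ : ∀ a → IsRNormal (⌜ a ⌝ₐ [ δ ]) → IsRNormal (⌜ a ⌝ₐ [ δ′ ])
    normal-δ′ₐ (v x)   p = ⌜⌝-normal (collapse (nf (δ x)))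
    normal-δ′ₐ (u ⊠ a) p = ⊗-normal (normal-δ′ u λ (_ , r) → p (_ , ⊗ₗ _ r))
                                    (normal-δ′ₐ a pa) (nonSum a pa (⊗-normal⁻ p))
      where
      pa : IsRNormal (⌜ a ⌝ₐ [ δ ])
      pa (_ , r) = p (_ , ⊗ᵣ _ r)
      nonSum : ∀ b → IsRNormal (⌜ b ⌝ₐ [ δ ]) → ¬ IsSum (⌜ b ⌝ₐ [ δ ]) → ¬ IsSum (⌜ b ⌝ₐ [ δ′ ])
      nonSum (v x)   q ns = nonSum-δ′ x q ns
      nonSum (_ ⊠ _) q ns (_ , _ , ())

  small-unifier : All (UnifiesNF δ) P → All (UnifiesNF δ′) P
  small-unifier us = All.tabulate λ {e} i → unify e i (All.lookup us i)
    where
    inParts : ∀ {w} → w ∈ sides P → All (_∈ parts) (subterms w)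
    inParts i = All.tabulate λ j → ∈-concatMap⁺ subterms (lose i j)
    unify : ∀ e → e ∈ P → UnifiesNF δ e → UnifiesNF δ′ e
    unify (s , t) i (eq , p) =
      ≡.trans (value-δ′ s (inParts (∈-concatMap⁺ _ (lose i (here ≡.refl)))))
        (≡.trans (cong collapse eq)
          (≡.sym (value-δ′ t (inParts (∈-concatMap⁺ _ (lose i (there (here ≡.refl)))))))) ,
      normal-δ′ (nf t) p

-- Finite search

terms : ℕ → List Term
terms zero    = var 0 ∷ []
-- The indices run up to `suc n` inclusive, because `height (var x)` is `x`.
terms (suc n) = map var (upTo (suc (suc n))) ++
  cartesianProductWith _⊕_ (terms n) (terms n) ++ cartesianProductWith _⊗_ (terms n) (terms n)

∈-terms : ∀ n t → height t ≤ n → t ∈ terms n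
∈-terms zero    (var zero) z≤n     = here ≡.refl
∈-terms (suc n) (var x)    p       = ∈-++⁺ˡ (∈-map⁺ var (∈-upTo⁺ (s≤s p)))
∈-terms (suc n) (s ⊕ t)    (s≤s p) = ∈-++⁺ʳ (map var (upTo (suc (suc n)))) (∈-++⁺ˡ
  (∈-cartesianProductWith⁺ _⊕_ (∈-terms n s (m⊔n≤o⇒m≤o _ _ p)) (∈-terms n t (m⊔n≤o⇒n≤o (height s) _ p))))
∈-terms (suc n) (s ⊗ t)    (s≤s p) = ∈-++⁺ʳ (map var (upTo (suc (suc n))))
  (∈-++⁺ʳ (cartesianProductWith _⊕_ (terms n) (terms n))
    (∈-cartesianProductWith⁺ _⊗_ (∈-terms n s (m⊔n≤o⇒m≤o _ _ p)) (∈-terms n t (m⊔n≤o⇒n≤o (height s) _ p))))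

_•_ : Term → Subst → Subst
(t • σ) zero    = t
(t • σ) (suc x) = σ x

substs : List Term → ℕ → List Subst
-- Past the first `m` variables the values are a mere default.
substs L zero    = var ∷ []
substs L (suc m) = cartesianProductWith _•_ L (substs L m)

_≗⟨_⟩_ : Subst → ℕ → Subst → Set
σ ≗⟨ m ⟩ τ = ∀ x → x < m → σ x ≡ τ x

substs-complete : ∀ L m δ → (∀ x → δ x ∈ L) → ∃ λ σ → σ ∈ substs L m × σ ≗⟨ m ⟩ δ
substs-complete L zero    δ δ∈ = var , here ≡.refl , λ _ ()
substs-complete L (suc m) δ δ∈ with substs-complete L m (δ ∘ suc) (δ∈ ∘ suc)
... | σ , σ∈ , eq = δ 0 • σ , ∈-cartesianProductWith⁺ _•_ (δ∈ 0) σ∈ ,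
  λ { zero _ → ≡.refl ; (suc x) (s≤s p) → eq x p }

varBound : Term → ℕ
varBound (var x) = suc x
varBound (s ⊕ t) = varBound s ⊔ varBound t
varBound (s ⊗ t) = varBound s ⊔ varBound t

[]-cong : ∀ {m σ τ} → σ ≗⟨ m ⟩ τ → ∀ t → varBound t ≤ m → t [ σ ] ≡ t [ τ ]
[]-cong eq (var x) p = eq x p
[]-cong eq (s ⊕ t) p =
  cong₂ _⊕_ ([]-cong eq s (m⊔n≤o⇒m≤o _ _ p)) ([]-cong eq t (m⊔n≤o⇒n≤o (varBound s) _ p))
[]-cong eq (s ⊗ t) p =
  cong₂ _⊗_ ([]-cong eq s (m⊔n≤o⇒m≤o _ _ p)) ([]-cong eq t (m⊔n≤o⇒n≤o (varBound s) _ p))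

-- `⌜ nf t ⌝` is bounded separately because the normality condition is about its instance.
varBounds : List AsymEq → ℕ
varBounds []            = 0
varBounds ((s , t) ∷ P) = (varBound s ⊔ (varBound t ⊔ varBound ⌜ nf t ⌝)) ⊔ varBounds P

unifiesNF-cong : ∀ {m σ τ} → σ ≗⟨ m ⟩ τ → ∀ P → varBounds P ≤ m →
                 All (UnifiesNF τ) P → All (UnifiesNF σ) P
unifiesNF-cong eq []            p []             = []
unifiesNF-cong {m} {σ} {τ} eq ((s , t) ∷ P) p ((q , r) ∷ us)
  = (≡.trans (cong nf ([]-cong eq s ps)) (≡.trans q (cong nf (≡.sym ([]-cong eq t pt)))) ,
     subst IsRNormal (≡.sym ([]-cong eq ⌜ nf t ⌝ pn)) r)
    ∷ unifiesNF-cong eq P (m⊔n≤o⇒n≤o (varBound s ⊔ _) _ p) us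
  where
  p₁ = m⊔n≤o⇒m≤o (varBound s ⊔ _) (varBounds P) p
  ps = m⊔n≤o⇒m≤o (varBound s) _ p₁
  p₂ = m⊔n≤o⇒n≤o (varBound s) _ p₁
  pt = m⊔n≤o⇒m≤o (varBound t) _ p₂
  pn = m⊔n≤o⇒n≤o (varBound t) _ p₂

candidates : List AsymEq → List Subst
candidates P = substs (terms (heightBound (complexity P))) (varBounds P)

-- The unifier found agrees with the collapsed `δ′`, of bounded height, on the variables of the
-- problem.
candidates-complete : ∀ P δ → All (UnifiesNF δ) P → Any (λ σ → All (UnifiesNF σ) P) (candidates P)
candidates-complete P δ us
  with substs-complete _ (varBounds P) δ′ (λ x → ∈-terms (heightBound (complexity P)) _ (height-δ′ x))
  where open SmallModel P δ
... | σ , σ∈ , eq = lose σ∈ (unifiesNF-cong eq P ≤-refl (SmallModel.small-unifier P δ us))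

theorem7p9 : (P : List AsymEq) → Dec (∃ λ δ → IsAsymUnifier δ P)
theorem7p9 P = map′
  (map₂ (All.map (λ {e} → unifies⇐ e)) ∘ Any.satisfied)
  (λ (δ , us) → candidates-complete P δ (All.map (λ {e} → unifies⇒ e) us))
  (any? (λ σ → All.all? (unifiesNF? σ) P) (candidates P))
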